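{- Let $\mathcal{G}=(V,\mathcal{E})$ be a plurigraph with $V=[n]$, and let $(V,E)\in\mathcal{E}$ be a contraction-ready pluriedge with contraction-ready composition $(B_1,\dots,B_\ell)$ and with $k\ge 0$ such that $B_i$ is a singleton if and only if $i>k$. Let $r_i=|B_i|-1$. Then $$Y_{\mathcal{G}}=Y_{\mathcal{G}\setminus(V,E)}-Y_{\mathcal{G}/(V,E)}\uparrow^{(r_1,r_2,\dots,r_k)}.$$
   Context: Let $\mathbb{P}=\{1,2,\dots\}$ and work in the ring of formal power series over a field $\mathbb{K}$ of characteristic zero in noncommuting variables $y_1,y_2,\dots$. A graph is a pair $(V,E)$ with $E$ a finite multiset of unordered pairs $uv$ of (not necessarily distinct) elements of $V$ (loops and multiple edges allowed). A plurigraph is a pair $\mathcal{G}=(V,\mathcal{E})$ with $V$ a finite set and $\mathcal{E}$ a finite multiset of graphs $(V,E)$ with vertex set $V$ and $E\neq\emptyset$ (pluriedges). A map $f:V\to\mathbb{P}$ is a proper coloring of $\mathcal{G}$ if for every pluriedge $(V,E)\in\mathcal{E}$ there is an edge $uv\in E$ with $f(u)\neq f(v)$. For $V=[n]$, the chromatic nc-symmetric function is $Y_{\mathcal{G}}=\sum_f y_{f(1)}y_{f(2)}\cdots y_{f(n)}$, summed over proper colorings $f$. Deletion: $\mathcal{G}\setminus(V,E)=(V,\mathcal{E}')$ where $\mathcal{E}'$ is $\mathcal{E}$ with one copy of $(V,E)$ removed. For disjoint $A,B\subseteq[n]$ write $A>B$ if $a>b$ for all $a\in A,b\in B$. A pluriedge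 $(V,E)$ is contraction-ready if the connected components of the graph $(V,E)$ can be ordered as $B_1,\dots,B_\ell$ with $B_i>B_j$ whenever $i<j$ and such that there is $k\ge0$ with $B_i$ a singleton iff $i>k$; $(B_1,\dots,B_\ell)$ is the contraction-ready composition. Contraction: $\mathcal{G}/(V,E)$ is the plurigraph with vertex set $[\ell]$, where all vertices of $B_i$ are identified to the single vertex $\ell-i+1$ (call this map $\phi:[n]\to[\ell]$), and whose pluriedge multiset is $\{([\ell],\{\phi(u)\phi(v): uv\in E'\}) : (V,E')\in\mathcal{E}'\}$ (edges taken as multisets; loops may arise). Induction: for nonnegative integers $r_1,\dots,r_k$ and a monomial $y_{i_1}\cdots y_{i_m}$ with $k\le m$, set $y_{i_1}\cdots y_{i_m}\uparrow^{(r_1,\dots,r_k)}=y_{i_1}\cdots y_{i_{m-k}}\,y_{i_{m-k+1}}^{1+r_k}\cdots y_{i_{m-1}}^{1+r_2}\,y_{i_m}^{1+r_1}$, extended linearly (termwise) to homogeneous series of degree $m$. -}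

module Defs where

open import Algebra.Apartness.Bundles using (HeytingCommutativeRing; HeytingField)
open import Algebra.Bundles using (CommutativeRing)
open import Data.Bool using (if_then_else_)
open import Data.Fin using (Fin; toℕ; inject≤; opposite)
import Data.Fin as Fin
open import Data.Fin.Subset using (Subset; _∈_; Nonempty; ⁅_⁆; ∣_∣)
open import Data.List using (List; []; _∷_; map; foldr; filter; replicate; reverse; upTo; cartesianProductWith; _++_)
open import Data.List.Extrema.Nat using (max)
import Data.List.Membership.Propositional as List
open import Data.List.NonEmpty using (List⁺)
import Data.List.NonEmpty as List⁺
import Data.List.Properties as List
open import Data.List.Relation.Unary.All using (All; all?)
open import Data.List.Relation.Unary.Any using (Any; any?; _─_)
open import Data.Nat using (ℕ; suc; _+_; _∸_; _≤_; _>_; z≤n; s≤s)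
import Data.Nat.Properties as ℕ
open import Data.Product using (_×_; _,_; ∃; proj₁; proj₂)
import Data.Product as Product
open import Data.Vec using (Vec; []; _∷_; lookup; tabulate; toList)
import Data.Vec as Vec
open import Function using (_⇔_; Injective)
open import Relation.Binary.Construct.Closure.Equivalence using (EqClosure)
open import Relation.Binary.Definitions using (DecidableEquality)
open import Relation.Binary.PropositionalEquality using (_≡_; _≢_; cong)
open import Relation.Nullary using (Dec; does; ¬_; ¬?)
open import Relation.Nullary.Decidable using (map′)
open import Relation.Unary using (Pred; Decidable)
open import Relation.Unary.Properties using (U?)

-- Positive integers; the element 1+ i stands for i + 1.
record ℙ : Set where
  constructor 1+_
  field
    pred : ℕ

value : ℙ → ℕ
value (1+ i) = suc i

_≟ℙ_ : DecidableEquality ℙ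
(1+ i) ≟ℙ (1+ j) = map′ (cong 1+_) (cong ℙ.pred) (i ℕ.≟ j)

-- Finite multisets are represented by lists and unordered pairs by pairs; the
-- order of a list and the orientation of a pair play no role in what follows.
-- The edge multiset of a pluriedge is nonempty.  Since all pluriedges of a
-- plurigraph have its vertex set V, only their edges are recorded.
Pluriedge : Set → Set
Pluriedge V = List⁺ (V × V)

Plurigraph : Set → Set
Plurigraph V = List (Pluriedge V)

ProperAt : ∀ {V} → (V → ℙ) → Pluriedge V → Set
ProperAt f E = Any (λ (u , v) → f u ≢ f v) (List⁺.toList E)

Proper : ∀ {V} → Plurigraph V → (V → ℙ) → Set
Proper 𝒢 f = All (ProperAt f) 𝒢

proper? : ∀ {V} (𝒢 : Plurigraph V) → Decidable (Proper 𝒢)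
proper? 𝒢 f =
  all? (λ E → any? (λ (u , v) → ¬? (f u ≟ℙ f v)) (List⁺.toList E)) 𝒢

-- Removes the occurrence of E that the membership proof points to.
delete : ∀ {V} (𝒢 : Plurigraph V) {E : Pluriedge V} → E List.∈ 𝒢 → Plurigraph V
delete 𝒢 E∈𝒢 = 𝒢 ─ E∈𝒢

identify : ∀ {V W} → (V → W) → Plurigraph V → Plurigraph W
identify φ = map (List⁺.map (Product.map φ φ))

-- From here on [n] is Fin n, with the vertex v of [n] given by v - 1.

Connected : ∀ {n} → Pluriedge (Fin n) → Fin n → Fin n → Set
Connected E = EqClosure (λ u v → (u , v) List.∈ List⁺.toList E)

IsComponent : ∀ {n} → Pluriedge (Fin n) → Subset n → Set
IsComponent E A =
  Nonempty A × (∀ {u} → u ∈ A → ∀ v → v ∈ A ⇔ Connected E u v)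

_≻_ : ∀ {n} → Subset n → Subset n → Set
A ≻ B = ∀ {a b} → a ∈ A → b ∈ B → a Fin.> b

Singleton : ∀ {n} → Subset n → Set
Singleton A = ∃ λ v → A ≡ ⁅ v ⁆

-- (B₁, …, B_ℓ) is the contraction-ready composition of E, and Bᵢ is a singleton
-- exactly for i > k.  The block Bᵢ is B (i - 1), with index in Fin ℓ.  The bound
-- k ≤ ℓ is what makes the sizes of B₁, …, B_k meaningful.
record IsContractionReady {n ℓ : ℕ} (E : Pluriedge (Fin n))
                          (B : Fin ℓ → Subset n) (k : ℕ) : Set where
  field
    component  : ∀ i → IsComponent E (B i)
    distinct   : Injective _≡_ _≡_ B
    covering   : ∀ v → ∃ λ i → v ∈ B i
    decreasing : ∀ {i j} → i Fin.< j → B i ≻ B j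
    k≤ℓ        : k ≤ ℓ
    singleton  : ∀ i → Singleton (B i) ⇔ suc (toℕ i) > k

  -- Sends Bᵢ to the vertex ℓ - i + 1 of [ℓ].
  φ : Fin n → Fin ℓ
  φ v = opposite (proj₁ (covering v))

  r : Vec ℕ k
  r = tabulate (λ i → ∣ B (inject≤ i k≤ℓ) ∣ ∸ 1)

contract : ∀ {n ℓ k} (𝒢 : Plurigraph (Fin n)) {E : Pluriedge (Fin n)}
           {B : Fin ℓ → Subset n} →
           E List.∈ 𝒢 → IsContractionReady E B k → Plurigraph (Fin ℓ)
contract 𝒢 E∈𝒢 ready = identify (IsContractionReady.φ ready) (delete 𝒢 E∈𝒢)

Word : Set
Word = List ℙ

_≟ʷ_ : DecidableEquality Word
_≟ʷ_ = List.≡-dec _≟ℙ_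

tuplesUpTo : (N m : ℕ) → List (Vec ℙ m)
tuplesUpTo N 0       = [] ∷ []
tuplesUpTo N (suc m) = cartesianProductWith _∷_ (map 1+_ (upTo N)) (tuplesUpTo N m)

repeatFirst : ∀ {k m} → k ≤ m → Vec ℕ k → Vec ℙ m → Word
repeatFirst z≤n       []       u       = toList u
repeatFirst (s≤s k≤m) (a ∷ as) (y ∷ u) = replicate (1 + a) y ++ repeatFirst k≤m as u

-- The exponents (r₁, …, r_k) are attached to the letters from the right: r₁ to
-- the last letter, r₂ to the one before it, and so on.
inducedWord : ∀ {k m} → k ≤ m → Vec ℕ k → Vec ℙ m → Word
inducedWord k≤m r u = reverse (repeatFirst k≤m r (Vec.reverse u))

module PowerSeries {c ℓ₁ ℓ₂} (K : HeytingField c ℓ₁ ℓ₂) where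

  open HeytingCommutativeRing (HeytingField.heytingCommutativeRing K)
    using (commutativeRing)
  open CommutativeRing commutativeRing
    using (Carrier; _≈_; 0#; 1#; _-_; +-rawMonoid)
    renaming (_+_ to _+ᴷ_; _*_ to _*ᴷ_)
  open import Algebra.Definitions.RawMonoid +-rawMonoid
    using () renaming (_×_ to _×ᴷ_)

  CharacteristicZero : Set ℓ₁
  CharacteristicZero = ∀ n → ¬ (suc n ×ᴷ 1# ≈ 0#)

  -- A formal power series in noncommuting variables, by its coefficients.
  Series : Set c
  Series = Word → Carrier

  infix 4 _≋_
  _≋_ : Series → Series → Set ℓ₁
  F ≋ G = ∀ w → F w ≈ G w

  infixl 6 _⊖_
  _⊖_ : Series → Series → Series
  (F ⊖ G) w = F w - G w

  infixr 7 _·_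
  _·_ : Carrier → Series → Series
  (a · F) w = a *ᴷ F w

  monomial : Word → Series
  monomial v w = if does (v ≟ʷ w) then 1# else 0#

  -- The infinite formal sum of the t u over all u in ℙᵐ satisfying P, for
  -- families in which t u is a multiple of a monomial containing every letter
  -- of u.  Then only the finitely many u whose letters are at most the largest
  -- letter of w can contribute to the coefficient of w.
  ∑ : ∀ {m p} {P : Pred (Vec ℙ m) p} → Decidable P → (Vec ℙ m → Series) → Series
  ∑ {m} P? t w =
    foldr _+ᴷ_ 0#
      (map (λ u → t u w) (filter P? (tuplesUpTo (max 0 (map value w)) m)))

  -- A coloring f of [n] is given by the tuple (f(1), …, f(n)).
  Y : ∀ {n} → Plurigraph (Fin n) → Series
  Y 𝒢 = ∑ (λ f → proper? 𝒢 (lookup f)) (λ f → monomial (toList f))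

  -- F is meant to be homogeneous of degree m, so that its terms are indexed by
  -- the words of length m.
  induce : ∀ {k m} → k ≤ m → Vec ℕ k → Series → Series
  induce {m = m} k≤m r F =
    ∑ {m} U? (λ u → F (toList u) · monomial (inducedWord k≤m r u))

{-# OPTIONS --safe #-}

-- Compare the coefficients of a word w.  If w is not of length n, all of them
-- vanish.  Otherwise w is a coloring f of [n].  If f is proper at E, then E may be
-- deleted, and w is not an induced word, since those are constant on the
-- components of E.  If f is not proper at E, then f is constant on the components
-- of E, so that f = u ∘ φ for exactly one coloring u of [ℓ]; the blocks being
-- intervals, w is the word induced from u, and u is proper on the contraction iff
-- f is proper on the deletion.
module Submission where

open import Defs
open import Algebra.Apartness.Bundles using (HeytingCommutativeRing; HeytingField)
open import Algebra.Bundles using (CommutativeRing)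
open import Data.Fin using (Fin; zero; suc; toℕ; fromℕ; inject₁; inject≤; opposite)
import Data.Fin as Fin
import Data.Fin.Properties as Fin
open import Data.Fin.Subset using (Subset; ∣_∣; inside; outside)
import Data.Fin.Subset as Subset
import Data.Fin.Subset.Properties as Subset
open import Data.List using (List; []; _∷_; _++_; map; foldr; filter; length; concat; replicate; reverse; tabulate)
open import Data.List.Extrema.Nat using (max; xs≤max)
open import Data.List.Membership.Propositional using (_∈_; find)
open import Data.List.Membership.Propositional.Properties
  using (∈-cartesianProductWith⁺; ∈-filter⁺; ∈-filter⁻; ∈-map⁺; ∈-upTo⁺)
import Data.List.NonEmpty as List⁺
open import Data.List.Properties
  using (filter-accept; filter-reject; map-∘; map-++; map-replicate; map-tabulate; reverse-involutive; reverse-map; unfold-reverse)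
import Data.List.Properties as List
open import Data.List.Relation.Binary.Permutation.Propositional using (↭-sym)
open import Data.List.Relation.Binary.Permutation.Propositional.Properties using (All-resp-↭; filter-↭; ↭-length; ↭-reverse)
open import Data.List.Relation.Unary.All using (All; []; _∷_)
import Data.List.Relation.Unary.All as All
import Data.List.Relation.Unary.All.Properties as All
open import Data.List.Relation.Unary.AllPairs using (AllPairs; []; _∷_)
import Data.List.Relation.Unary.AllPairs.Properties as AllPairs
open import Data.List.Relation.Unary.Any using (Any; here; there; any?)
import Data.List.Relation.Unary.Any as Any
import Data.List.Relation.Unary.Any.Properties as Any
open import Data.List.Relation.Unary.Unique.Propositional using (Unique)
import Data.List.Relation.Unary.Unique.Propositional.Properties as Unique
open import Data.Nat using (ℕ; zero; suc; _≤_; z≤n; s≤s; s≤s⁻¹)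
import Data.Nat.Properties as ℕ
open import Data.Product using (_×_; _,_; ∃₂; proj₁; proj₂)
open import Data.Unit using (tt)
open import Data.Vec using (Vec; []; _∷_; _∷ʳ_; lookup; toList; fromList; here; there)
import Data.Vec as Vec
import Data.Vec.Properties as Vec
open import Function using (_⇔_; mk⇔; Equivalence; case_of_; _∘_; flip)
open import Level using (Level)
open import Relation.Binary using (Rel; tri<; tri≈; tri>)
import Relation.Binary.Construct.Closure.Equivalence as EqClosure
open import Relation.Binary.PropositionalEquality
  using (_≡_; _≢_; refl; sym; trans; cong; cong₂; subst; module ≡-Reasoning)
import Relation.Binary.PropositionalEquality as ≡
import Relation.Binary.Reasoning.Setoid as SetoidReasoning
open import Relation.Nullary using (¬_; yes; no; ¬?; contradiction)
open import Relation.Nullary.Decidable using (decidable-stable)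
open import Relation.Unary using (Pred; Decidable)
open import Relation.Unary.Properties using (U?)

open Equivalence using (to; from)

private
  variable
    a p ρ : Level
    A : Set a
    V W : Set
    k ℓ m n : ℕ

-- Lists and vectors

AllPairs-reverse⁺ : {R : Rel A ρ} {xs : List A} → AllPairs R xs → AllPairs (flip R) (reverse xs)
AllPairs-reverse⁺ [] = []
AllPairs-reverse⁺ {xs = x ∷ xs} (x~xs ∷ xs~) rewrite unfold-reverse x xs =
  AllPairs.++⁺ (AllPairs-reverse⁺ xs~) ([] ∷ []) (All.map (_∷ []) (All-resp-↭ (↭-sym (↭-reverse xs)) x~xs))

toList-tabulate : (f : Fin n → A) → toList (Vec.tabulate f) ≡ tabulate f
toList-tabulate {n = zero}  f = refl
toList-tabulate {n = suc n} f = cong (f zero ∷_) (toList-tabulate (f ∘ suc))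

toList-injective : {xs ys : Vec A n} → toList xs ≡ toList ys → xs ≡ ys
toList-injective {xs = xs} {ys} eq =
  trans (sym (Vec.cast-is-id refl xs)) (Vec.toList-injective refl xs ys eq)

lookup-injective : {xs ys : Vec A n} → (∀ i → lookup xs i ≡ lookup ys i) → xs ≡ ys
lookup-injective {xs = xs} {ys} eq =
  trans (sym (Vec.tabulate∘lookup xs)) (trans (Vec.tabulate-cong eq) (Vec.tabulate∘lookup ys))

lookup-∷ʳ-fromℕ : (xs : Vec A n) (x : A) → lookup (xs ∷ʳ x) (fromℕ n) ≡ x
lookup-∷ʳ-fromℕ []       x = refl
lookup-∷ʳ-fromℕ (_ ∷ xs) x = lookup-∷ʳ-fromℕ xs x

lookup-∷ʳ-inject₁ : (xs : Vec A n) (x : A) (i : Fin n) → lookup (xs ∷ʳ x) (inject₁ i) ≡ lookup xs i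
lookup-∷ʳ-inject₁ (_ ∷ xs) x zero    = refl
lookup-∷ʳ-inject₁ (_ ∷ xs) x (suc i) = lookup-∷ʳ-inject₁ xs x i

-- `inducedWord` first reverses `u`, while `φ` takes the opposite of a block index; by this rule the
-- two reversals cancel.
lookup-reverse-opposite : (xs : Vec A n) (i : Fin n) → lookup (Vec.reverse xs) (opposite i) ≡ lookup xs i
lookup-reverse-opposite (x ∷ xs) zero rewrite Vec.reverse-∷ x xs =
  lookup-∷ʳ-fromℕ (Vec.reverse xs) x
lookup-reverse-opposite (x ∷ xs) (suc i) rewrite Vec.reverse-∷ x xs =
  trans (lookup-∷ʳ-inject₁ (Vec.reverse xs) x (opposite i)) (lookup-reverse-opposite xs i)

-- Sorted lists as concatenations of constant blocks

count : Fin m → List (Fin m) → ℕ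
count i cs = length (filter (i Fin.≟_) cs)

count-reverse : (i : Fin m) (cs : List (Fin m)) → count i (reverse cs) ≡ count i cs
count-reverse i cs = ↭-length (filter-↭ (i Fin.≟_) (↭-reverse cs))

count-zero-map-suc : (cs : List (Fin m)) → count zero (map suc cs) ≡ 0
count-zero-map-suc []       = refl
count-zero-map-suc (c ∷ cs) = count-zero-map-suc cs

count-suc-map-suc : (i : Fin m) (cs : List (Fin m)) → count (suc i) (map suc cs) ≡ count i cs
count-suc-map-suc i []       = refl
count-suc-map-suc i (c ∷ cs) with i Fin.≟ c
... | yes _ = cong suc (count-suc-map-suc i cs)
... | no  _ = count-suc-map-suc i cs

count-zero-zeros++suc : ∀ q (cs : List (Fin m)) → count zero (replicate q zero ++ map suc cs) ≡ q
count-zero-zeros++suc zero    cs = count-zero-map-suc cs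
count-zero-zeros++suc (suc q) cs = cong suc (count-zero-zeros++suc q cs)

count-suc-zeros++suc : ∀ q (i : Fin m) cs → count (suc i) (replicate q zero ++ map suc cs) ≡ count i cs
count-suc-zeros++suc zero    i cs = count-suc-map-suc i cs
count-suc-zeros++suc (suc q) i cs = count-suc-zeros++suc q i cs

Sorted : List (Fin m) → Set
Sorted = AllPairs Fin._≤_

-- Nothing nonzero precedes a zero in a sorted list, so the zeros form a prefix. Lowering the other
-- entries by one leaves a sorted list over fewer indices, ready for induction.
sorted-zeros++suc : {cs : List (Fin (suc m))} → Sorted cs →
                    ∃₂ λ q ds → cs ≡ replicate q zero ++ map suc ds × Sorted ds
sorted-zeros++suc [] = 0 , [] , refl , []
sorted-zeros++suc {cs = zero ∷ cs} (_ ∷ cs↗) with sorted-zeros++suc cs↗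
... | q , ds , refl , ds↗ = suc q , ds , refl , ds↗
sorted-zeros++suc {cs = suc c ∷ cs} (c≤cs ∷ cs↗) with sorted-zeros++suc cs↗
... | zero  , ds , refl , ds↗ = 0 , c ∷ ds , refl , All.map s≤s⁻¹ (All.map⁻ c≤cs) ∷ ds↗
... | suc q , ds , refl , ds↗ with () ← All.head c≤cs

-- Common normal form: both the output of `repeatFirst` and the image of a sorted list of indices
-- are brought to this shape.
blocks : (Fin m → ℕ) → (Fin m → A) → List A
blocks s f = concat (tabulate λ i → replicate (s i) (f i))

blocks-cong : {s t : Fin m → ℕ} {f : Fin m → A} → (∀ i → s i ≡ t i) → blocks s f ≡ blocks t f
blocks-cong s≗t = cong concat (List.tabulate-cong λ i → cong (λ x → replicate x _) (s≗t i))

-- Induction on the number of indices: the leading zeros give the first run, and the rest is handled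
-- with `f` shifted by one.
sorted-blocks : {cs : List (Fin m)} (f : Fin m → A) → Sorted cs →
                map f cs ≡ blocks (λ i → count i cs) f
sorted-blocks {m = zero}  {cs = []} f _   = refl
sorted-blocks {m = suc m} {cs = cs} f cs↗ with sorted-zeros++suc cs↗
... | q , ds , refl , ds↗ = begin
  map f (replicate q zero ++ map suc ds)
    ≡⟨ map-++ f (replicate q zero) (map suc ds) ⟩
  map f (replicate q zero) ++ map f (map suc ds)
    ≡⟨ cong₂ _++_ (map-replicate f q zero) (sym (map-∘ ds)) ⟩
  replicate q (f zero) ++ map (f ∘ suc) ds
    ≡⟨ cong (_ ++_) (sorted-blocks (f ∘ suc) ds↗) ⟩
  replicate q (f zero) ++ blocks (λ i → count i ds) (f ∘ suc)
    ≡⟨ cong₂ _++_ (cong (λ x → replicate x (f zero)) (count-zero-zeros++suc q ds))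
                  (blocks-cong (λ i → count-suc-zeros++suc q i ds)) ⟨
  blocks (λ i → count i (replicate q zero ++ map suc ds)) f ∎
  where open ≡-Reasoning

-- `s` gives a multiplicity to every letter, also to those beyond the first `k`, for which `r` has
-- no entry. Thus the sizes of all blocks can serve as `s`.
repeatFirst-blocks : (k≤m : k ≤ m) (r : Vec ℕ k) (u : Vec ℙ m) (s : Fin m → ℕ) →
                     (∀ i → s (inject≤ i k≤m) ≡ suc (lookup r i)) →
                     (∀ i → k ≤ toℕ i → s i ≡ 1) →
                     repeatFirst k≤m r u ≡ blocks s (lookup u)
repeatFirst-blocks z≤n [] [] s s≡r s≡1 = refl
repeatFirst-blocks z≤n [] (y ∷ u) s s≡r s≡1 rewrite s≡1 zero z≤n =
  cong (y ∷_) (repeatFirst-blocks z≤n [] u (s ∘ suc) (λ ()) (λ i _ → s≡1 (suc i) z≤n))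
repeatFirst-blocks (s≤s k≤m) (a ∷ as) (y ∷ u) s s≡r s≡1 rewrite s≡r zero =
  cong (replicate (suc a) y ++_)
    (repeatFirst-blocks k≤m as u (s ∘ suc) (s≡r ∘ suc) (λ i → s≡1 (suc i) ∘ s≤s))

-- The enumeration `b` is arbitrary so that the induction can pass to `b ∘ suc`; in the application
-- it lists the block indices of the vertices.
∣∣≡length-filter : {P : Pred A p} (P? : Decidable P) (b : Fin n → A) (S : Subset n) →
                   (∀ v → v Subset.∈ S ⇔ P (b v)) → ∣ S ∣ ≡ length (filter P? (tabulate b))
∣∣≡length-filter P? b [] S⇔P = refl
∣∣≡length-filter P? b (x ∷ S) S⇔P
  with ih ← ∣∣≡length-filter P? (b ∘ suc) S
              (λ v → mk⇔ (to (S⇔P (suc v)) ∘ there) (Subset.drop-there ∘ from (S⇔P (suc v))))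
  with x
... | inside  = trans (cong suc ih) (sym (cong length (filter-accept P? (to (S⇔P zero) here))))
... | outside = trans ih (sym (cong length (filter-reject P? λ Pb → case from (S⇔P zero) Pb of λ ())))

-- Proper colorings

ProperAt-cong : {f g : V → ℙ} → (∀ v → f v ≡ g v) → ∀ {E} → ProperAt f E → ProperAt g E
ProperAt-cong f≗g = Any.map λ {(u , v)} fu≢fv gu≡gv →
  fu≢fv (trans (f≗g u) (trans gu≡gv (sym (f≗g v))))

Proper-cong : {f g : V → ℙ} → (∀ v → f v ≡ g v) → ∀ {𝒢} → Proper 𝒢 f → Proper 𝒢 g
Proper-cong f≗g = All.map λ {E} → ProperAt-cong f≗g {E}

-- The colors of `φ u` and `φ v` under `g` are those of `u` and `v` under `g ∘ φ`. An edge that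
-- becomes a loop has ends of one color on either side.
Proper-identify : (φ : V → W) (𝒢 : Plurigraph V) {g : W → ℙ} →
                  Proper (identify φ 𝒢) g ⇔ Proper 𝒢 (g ∘ φ)
Proper-identify φ 𝒢 = mk⇔ (All.map Any.map⁻ ∘ All.map⁻) (All.map⁺ ∘ All.map Any.map⁺)

Proper-delete : {𝒢 : Plurigraph V} {E : Pluriedge V} (E∈𝒢 : E ∈ 𝒢) {f : V → ℙ} → ProperAt f E →
                Proper 𝒢 f ⇔ Proper (delete 𝒢 E∈𝒢) f
-- `All.─⁻` asks for properness at the list entry that `E∈𝒢` points to, which equals `E` only
-- propositionally.
Proper-delete E∈𝒢 fE = mk⇔ (All.─⁺ E∈𝒢) (All.─⁻ E∈𝒢 (subst (ProperAt _) (Any.lookup-result E∈𝒢) fE))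

-- Equality of colors is decidable, so failing at `E` means that every edge has ends of one color.
-- Having the same color is an equivalence relation, hence it extends from edges to connected
-- vertices.
improper-const : {f : Fin n → ℙ} {E : Pluriedge (Fin n)} → ¬ ProperAt f E →
                 ∀ {u v} → Connected E u v → f u ≡ f v
improper-const {f = f} {E} ¬fE = EqClosure.gfold ≡.isEquivalence f λ {u} {v} uv∈E →
  decidable-stable (f u ≟ℙ f v) λ fu≢fv → ¬fE (Any.map (λ { refl → fu≢fv }) uv∈E)

-- Blocks of a contraction-ready pluriedge

module ContractionReady {E : Pluriedge (Fin n)} {B : Fin ℓ → Subset n} (ready : IsContractionReady E B k) where

  open IsContractionReady ready

  block : Fin n → Fin ℓ
  block v = proj₁ (covering v)

  ∈-block : ∀ v → v Subset.∈ B (block v)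
  ∈-block v = proj₂ (covering v)

  -- A vertex common to two different blocks would, by `decreasing`, be greater than itself.
  ∈B⇔block : ∀ {i} v → v Subset.∈ B i ⇔ i ≡ block v
  ∈B⇔block {i} v = mk⇔ to′ λ { refl → ∈-block v }
    where
    to′ : v Subset.∈ B i → i ≡ block v
    to′ v∈Bi with Fin.<-cmp i (block v)
    ... | tri< i<b _ _ = contradiction (decreasing i<b v∈Bi (∈-block v)) (Fin.<-irrefl refl)
    ... | tri≈ _ i≡b _ = i≡b
    ... | tri> _ _ i>b = contradiction (decreasing i>b (∈-block v) v∈Bi) (Fin.<-irrefl refl)

  -- This is the interval property of the blocks: the list of block indices along `[n]`, read
  -- backwards, is sorted.
  block-antitone : ∀ {u v} → u Fin.< v → block v Fin.≤ block u
  block-antitone {u} {v} u<v = ℕ.≮⇒≥ λ bu<bv →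
    ℕ.<-asym u<v (decreasing bu<bv (∈-block u) (∈-block v))

  ∈B⇔Connected : ∀ {i u v} → u Subset.∈ B i → (v Subset.∈ B i) ⇔ Connected E u v
  ∈B⇔Connected {i} {v = v} u∈Bi = proj₂ (component i) u∈Bi v

  representative : Fin ℓ → Fin n
  representative i = proj₁ (proj₁ (component i))

  representative-∈ : ∀ i → representative i Subset.∈ B i
  representative-∈ i = proj₂ (proj₁ (component i))

  -- A right inverse of `φ`, by which a coloring of `[ℓ]` can be read off from one of `[n]`.
  section : Fin ℓ → Fin n
  section j = representative (opposite j)

  φ-section : ∀ j → φ (section j) ≡ j
  φ-section j = trans
    (cong opposite (sym (to (∈B⇔block (section j)) (representative-∈ (opposite j)))))
    (Fin.opposite-involutive j)

  section-φ-connected : ∀ v → Connected E (section (φ v)) v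
  section-φ-connected v = to (∈B⇔Connected (representative-∈ _))
    (subst (λ i → v Subset.∈ B i) (sym (Fin.opposite-involutive (block v))) (∈-block v))

  -- Both ends of an edge of `E` lie in one component, so `φ` identifies them.
  φ-improper : (g : Fin ℓ → ℙ) → ¬ ProperAt (g ∘ φ) E
  φ-improper g gφE with find gφE
  ... | (u , v) , uv∈E , gφu≢gφv = gφu≢gφv (cong (g ∘ opposite)
    (to (∈B⇔block v) (from (∈B⇔Connected (∈-block u)) (EqClosure.return uv∈E))))

  -- Components are nonempty, so the truncated subtraction in `r` can be undone.
  sizes-r : ∀ i → ∣ B (inject≤ i k≤ℓ) ∣ ≡ suc (lookup r i)
  sizes-r i = trans (sym (ℕ.m+[n∸m]≡n nonempty)) (cong suc (sym (Vec.lookup∘tabulate _ i)))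
    where
    nonempty : 1 ≤ ∣ B (inject≤ i k≤ℓ) ∣
    -- Removing the representative strictly lowers the size, which is therefore positive.
    nonempty = ℕ.≤-<-trans z≤n (Subset.x∈p⇒∣p-x∣<∣p∣ (representative-∈ (inject≤ i k≤ℓ)))

  sizes-1 : ∀ i → k ≤ toℕ i → ∣ B i ∣ ≡ 1
  sizes-1 i k≤i with from (singleton i) (s≤s k≤i)
  ... | v , Bi≡⁅v⁆ = trans (cong ∣_∣ Bi≡⁅v⁆) (Subset.∣⁅x⁆∣≡1 v)

  -- The word of `u ∘ φ` is constant on blocks, and blocks are intervals, so it consists of runs
  -- whose lengths are the block sizes. As the first block comes last in `[n]`, the words are
  -- compared backwards, where block indices increase and the exponents appear in their order.
  inducedWord-φ : ∀ u → inducedWord k≤ℓ r u ≡ toList (Vec.tabulate (lookup u ∘ φ))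
  inducedWord-φ u = begin
    reverse (repeatFirst k≤ℓ r ũ)
      ≡⟨ cong reverse (repeatFirst-blocks k≤ℓ r ũ (λ i → ∣ B i ∣) sizes-r sizes-1) ⟩
    reverse (blocks (λ i → ∣ B i ∣) (lookup ũ))
      -- Counts ignore order, so they may be taken over the reversed list of block indices, which is
      -- the sorted one.
      ≡⟨ cong reverse (blocks-cong λ i → trans (∣∣≡length-filter (i Fin.≟_) block (B i) ∈B⇔block)
                                               (sym (count-reverse i (tabulate block)))) ⟩
    reverse (blocks (λ i → count i (reverse (tabulate block))) (lookup ũ))
      ≡⟨ cong reverse (sorted-blocks (lookup ũ) (AllPairs-reverse⁺ (AllPairs.tabulate⁺-< block-antitone))) ⟨
    reverse (map (lookup ũ) (reverse (tabulate block)))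
      ≡⟨ cong reverse (reverse-map (lookup ũ) (tabulate block)) ⟩
    reverse (reverse (map (lookup ũ) (tabulate block)))
      ≡⟨ reverse-involutive _ ⟩
    map (lookup ũ) (tabulate block)
      ≡⟨ map-tabulate block (lookup ũ) ⟩
    tabulate (lookup ũ ∘ block)
      ≡⟨ List.tabulate-cong (λ v → trans (cong (lookup ũ) (sym (Fin.opposite-involutive (block v))))
                                         (lookup-reverse-opposite u (φ v))) ⟩
    tabulate (lookup u ∘ φ)
      ≡⟨ toList-tabulate (lookup u ∘ φ) ⟨
    toList (Vec.tabulate (lookup u ∘ φ)) ∎
    where
    open ≡-Reasoning
    ũ = Vec.reverse u

  length-inducedWord : ∀ u → length (inducedWord k≤ℓ r u) ≡ n
  length-inducedWord u = trans (cong length (inducedWord-φ u)) (Vec.length-toList (Vec.tabulate (lookup u ∘ φ)))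

  -- Turns an equation of words into the factorization of `f` through `φ`, the form used whether or
  -- not `f` is proper at `E`.
  inducedWord≡⇔ : ∀ u f → inducedWord k≤ℓ r u ≡ toList f ⇔ (∀ v → lookup u (φ v) ≡ lookup f v)
  inducedWord≡⇔ u f = mk⇔
    (λ eq v → trans (sym (Vec.lookup∘tabulate (lookup u ∘ φ) v))
                    (cong (λ g → lookup g v) (toList-injective (trans (sym (inducedWord-φ u)) eq))))
    (λ eq → trans (inducedWord-φ u)
                  (cong toList (trans (Vec.tabulate-cong eq) (Vec.tabulate∘lookup f))))

-- Coefficients of the series

-- The sum `∑` is cut off at the largest letter of the word; this bound keeps the contributing tuple
-- in range.
letters≤max : (f : Vec ℙ n) → ∀ i → value (lookup f i) ≤ max 0 (map value (toList f))
letters≤max f = bounded f (All.map⁻ (xs≤max 0 (map value (toList f))))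
  where
  bounded : ∀ {n N} (g : Vec ℙ n) → All (λ y → value y ≤ N) (toList g) → ∀ i → value (lookup g i) ≤ N
  bounded (_ ∷ g) (y≤N ∷ _)   zero    = y≤N
  bounded (_ ∷ g) (_   ∷ g≤N) (suc i) = bounded g g≤N i

∈-tuplesUpTo : ∀ {N} (u : Vec ℙ m) → (∀ i → value (lookup u i) ≤ N) → u ∈ tuplesUpTo N m
∈-tuplesUpTo []      u≤N = here refl
∈-tuplesUpTo (y ∷ u) u≤N =
  -- With `y` written as `1+ i`, the bound `suc i ≤ N` is by definition `i < N`, hence membership in
  -- `upTo N`.
  ∈-cartesianProductWith⁺ _∷_ (∈-map⁺ 1+_ (∈-upTo⁺ (u≤N zero))) (∈-tuplesUpTo u (u≤N ∘ suc))

-- Ensures that a single contributing tuple is counted only once.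
tuplesUpTo-unique : ∀ N m → Unique (tuplesUpTo N m)
tuplesUpTo-unique N zero    = [] ∷ []
tuplesUpTo-unique N (suc m) = Unique.cartesianProductWith⁺ _∷_ Vec.∷-injective
  (Unique.map⁺ (cong ℙ.pred) (Unique.upTo⁺ N)) (tuplesUpTo-unique N m)

module Coefficients {c ℓ₁ ℓ₂} (K : HeytingField c ℓ₁ ℓ₂) where

  open PowerSeries K
  open HeytingCommutativeRing (HeytingField.heytingCommutativeRing K) using (commutativeRing)
  open CommutativeRing commutativeRing hiding (zero)
    renaming (refl to ≈-refl; sym to ≈-sym; trans to ≈-trans)

  sum-zero : (t : A → Carrier) (xs : List A) → (∀ {x} → x ∈ xs → t x ≈ 0#) → foldr _+_ 0# (map t xs) ≈ 0#
  sum-zero t []       t≈0 = ≈-refl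
  sum-zero t (x ∷ xs) t≈0 =
    ≈-trans (+-cong (t≈0 (here refl)) (sum-zero t xs (t≈0 ∘ there))) (+-identityˡ 0#)

  sum-single : (t : A → Carrier) {xs : List A} {x₀ : A} → Unique xs → x₀ ∈ xs →
               (∀ {x} → x ∈ xs → x ≢ x₀ → t x ≈ 0#) → foldr _+_ 0# (map t xs) ≈ t x₀
  sum-single t {x ∷ xs} (x∉xs ∷ _) (here refl) t≈0 =
    ≈-trans (+-congˡ (sum-zero t xs λ y∈xs → t≈0 (there y∈xs) λ y≡x → All.lookup x∉xs y∈xs (sym y≡x)))
            (+-identityʳ (t x))
  sum-single t {x ∷ xs} (x∉xs ∷ xs!) (there x₀∈xs) t≈0 =
    ≈-trans (+-cong (t≈0 (here refl) (All.lookup x∉xs x₀∈xs)) (sum-single t xs! x₀∈xs (t≈0 ∘ there)))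
            (+-identityˡ _)

  module _ {P : Pred (Vec ℙ m) p} (P? : Decidable P) (t : Vec ℙ m → Series) (w : Word) where

    ∑-zero : (∀ u → P u → t u w ≈ 0#) → ∑ P? t w ≈ 0#
    ∑-zero t≈0 = sum-zero (λ u → t u w) (filter P? tuples) λ {u} u∈ →
      t≈0 u (proj₂ (∈-filter⁻ P? {xs = tuples} u∈))
      where tuples = tuplesUpTo (max 0 (map value w)) m

    ∑-single : ∀ {u₀} → (∀ i → value (lookup u₀ i) ≤ max 0 (map value w)) → P u₀ →
               (∀ u → u ≢ u₀ → t u w ≈ 0#) → ∑ P? t w ≈ t u₀ w
    ∑-single {u₀} u₀≤ Pu₀ t≈0 = sum-single (λ u → t u w)
      (Unique.filter⁺ P? (tuplesUpTo-unique _ m))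
      (∈-filter⁺ P? (∈-tuplesUpTo u₀ u₀≤) Pu₀)
      (λ {u} _ → t≈0 u)

  monomial-≡ : ∀ v w → v ≡ w → monomial v w ≈ 1#
  monomial-≡ v w v≡w with v ≟ʷ w
  ... | yes _   = ≈-refl
  ... | no  v≢w = contradiction v≡w v≢w

  monomial-≢ : ∀ v w → v ≢ w → monomial v w ≈ 0#
  monomial-≢ v w v≢w with v ≟ʷ w
  ... | yes v≡w = contradiction v≡w v≢w
  ... | no  _   = ≈-refl

  Y-length : (𝒢 : Plurigraph (Fin n)) {w : Word} → length w ≢ n → Y 𝒢 w ≈ 0#
  Y-length 𝒢 {w} ∣w∣≢n = ∑-zero (λ f → proper? 𝒢 (lookup f)) (λ f → monomial (toList f)) w
    λ f _ → monomial-≢ (toList f) w λ f≡w → ∣w∣≢n (trans (cong length (sym f≡w)) (Vec.length-toList f))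

  Y-proper : (𝒢 : Plurigraph (Fin n)) (f : Vec ℙ n) → Proper 𝒢 (lookup f) → Y 𝒢 (toList f) ≈ 1#
  Y-proper 𝒢 f f-proper = ≈-trans
    (∑-single (λ g → proper? 𝒢 (lookup g)) (λ g → monomial (toList g)) (toList f) (letters≤max f) f-proper
      λ g g≢f → monomial-≢ (toList g) (toList f) (g≢f ∘ toList-injective))
    (monomial-≡ (toList f) (toList f) refl)

  Y-improper : (𝒢 : Plurigraph (Fin n)) (f : Vec ℙ n) → ¬ Proper 𝒢 (lookup f) → Y 𝒢 (toList f) ≈ 0#
  Y-improper 𝒢 f ¬f-proper = ∑-zero (λ g → proper? 𝒢 (lookup g)) (λ g → monomial (toList g)) (toList f)
    λ g g-proper → monomial-≢ (toList g) (toList f) λ g≡f →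
      ¬f-proper (subst (λ h → Proper 𝒢 (lookup h)) (toList-injective g≡f) g-proper)

  -- Each of these coefficients is 1 or 0 according to properness, which is decidable. The vertex
  -- sets may differ, as they do for a contraction and a deletion.
  Y-cong : (𝒢 : Plurigraph (Fin m)) (ℋ : Plurigraph (Fin n)) (f : Vec ℙ m) (g : Vec ℙ n) →
           Proper 𝒢 (lookup f) ⇔ Proper ℋ (lookup g) → Y 𝒢 (toList f) ≈ Y ℋ (toList g)
  Y-cong 𝒢 ℋ f g f⇔g with proper? 𝒢 (lookup f)
  ... | yes f-proper = ≈-trans (Y-proper 𝒢 f f-proper) (≈-sym (Y-proper ℋ g (to f⇔g f-proper)))
  ... | no ¬f-proper = ≈-trans (Y-improper 𝒢 f ¬f-proper) (≈-sym (Y-improper ℋ g (¬f-proper ∘ from f⇔g)))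

  induce-zero : (k≤m : k ≤ m) (r : Vec ℕ k) (F : Series) {w : Word} →
                (∀ u → inducedWord k≤m r u ≢ w) → induce k≤m r F w ≈ 0#
  induce-zero k≤m r F {w} ≢w = ∑-zero U? (λ u → F (toList u) · monomial (inducedWord k≤m r u)) w
    λ u _ → ≈-trans (*-congˡ (monomial-≢ _ w (≢w u))) (zeroʳ _)

  -- The coefficient of `w` collects those of `F` at all `u` inducing `w`; here only `u₀` remains,
  -- and the bound keeps it in range.
  induce-single : (k≤m : k ≤ m) (r : Vec ℕ k) (F : Series) {w : Word} {u₀ : Vec ℙ m} →
                  (∀ i → value (lookup u₀ i) ≤ max 0 (map value w)) →
                  (∀ u → inducedWord k≤m r u ≡ w ⇔ u ≡ u₀) →
                  induce k≤m r F w ≈ F (toList u₀)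
  induce-single k≤m r F {w} {u₀} u₀≤ ≡w⇔ = ≈-trans
    (∑-single U? (λ u → F (toList u) · monomial (inducedWord k≤m r u)) w u₀≤ tt
      λ u u≢u₀ → ≈-trans (*-congˡ (monomial-≢ _ w (u≢u₀ ∘ to (≡w⇔ u)))) (zeroʳ _))
    (≈-trans (*-congˡ (monomial-≡ _ w (from (≡w⇔ u₀) refl))) (*-identityʳ _))

  x≈x-0 : ∀ {x y z} → x ≈ y → z ≈ 0# → x ≈ y - z
  x≈x-0 {x} {y} {z} x≈y z≈0 = begin
    x         ≈⟨ x≈y ⟩
    y         ≈⟨ +-identityʳ y ⟨
    y + 0#    ≈⟨ +-congˡ (-‿inverseʳ 0#) ⟨
    y + (0# - 0#) ≈⟨ +-congˡ (+-identityˡ (- 0#)) ⟩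
    y - 0#    ≈⟨ +-congˡ (-‿cong z≈0) ⟨
    y - z     ∎
    where open SetoidReasoning setoid

  -- Deletion-contraction, one coefficient at a time

  module _ {𝒢 : Plurigraph (Fin n)} {E : Pluriedge (Fin n)} (E∈𝒢 : E ∈ 𝒢)
           {B : Fin ℓ → Subset n} (ready : IsContractionReady E B k) where

    open IsContractionReady ready
    open ContractionReady ready

    Contraction : Series
    Contraction = Y (contract 𝒢 E∈𝒢 ready)

    deletion-contraction-length : ∀ {w} → length w ≢ n →
      Y 𝒢 w ≈ Y (delete 𝒢 E∈𝒢) w - induce k≤ℓ r Contraction w
    deletion-contraction-length ∣w∣≢n = x≈x-0
      (≈-trans (Y-length 𝒢 ∣w∣≢n) (≈-sym (Y-length (delete 𝒢 E∈𝒢) ∣w∣≢n)))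
      (induce-zero k≤ℓ r Contraction λ u u≡w →
        ∣w∣≢n (trans (cong length (sym u≡w)) (length-inducedWord u)))

    -- If some `u` induced the word of `f`, then `f` would be `u ∘ φ` and so improper at `E`.
    deletion-contraction-proper : ∀ f → ProperAt (lookup f) E →
      Y 𝒢 (toList f) ≈ Y (delete 𝒢 E∈𝒢) (toList f) - induce k≤ℓ r Contraction (toList f)
    deletion-contraction-proper f fE = x≈x-0
      (Y-cong 𝒢 (delete 𝒢 E∈𝒢) f f (Proper-delete E∈𝒢 fE))
      (induce-zero k≤ℓ r Contraction λ u u≡f →
        φ-improper (lookup u) (ProperAt-cong (sym ∘ to (inducedWord≡⇔ u f) u≡f) {E} fE))

    -- As `f` violates `E`, the left side is 0, and it remains to see that the two terms on the
    -- right cancel.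
    deletion-contraction-improper : ∀ f → ¬ ProperAt (lookup f) E →
      Y 𝒢 (toList f) ≈ Y (delete 𝒢 E∈𝒢) (toList f) - induce k≤ℓ r Contraction (toList f)
    deletion-contraction-improper f ¬fE = begin
      Y 𝒢 (toList f)
        ≈⟨ Y-improper 𝒢 f (λ f-proper → ¬fE (All.lookup f-proper E∈𝒢)) ⟩
      0#
        ≈⟨ -‿inverseʳ _ ⟨
      Y (delete 𝒢 E∈𝒢) (toList f) - Y (delete 𝒢 E∈𝒢) (toList f)
        ≈⟨ +-congˡ (-‿cong induced≈deleted) ⟨
      Y (delete 𝒢 E∈𝒢) (toList f) - induce k≤ℓ r Contraction (toList f) ∎
      where
      open SetoidReasoning setoid

      -- Any `u` with `u ∘ φ = f` must take these values, since `section` is a right inverse of `φ`.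
      -- Conversely they do factor `f`, which is constant on components.
      u₀ : Vec ℙ ℓ
      u₀ = Vec.tabulate (lookup f ∘ section)

      u₀-section : ∀ j → lookup u₀ j ≡ lookup f (section j)
      u₀-section = Vec.lookup∘tabulate (lookup f ∘ section)

      u₀∘φ≗f : ∀ v → lookup u₀ (φ v) ≡ lookup f v
      u₀∘φ≗f v = trans (u₀-section (φ v)) (improper-const {f = lookup f} ¬fE (section-φ-connected v))

      inducedWord≡⇔u₀ : ∀ u → inducedWord k≤ℓ r u ≡ toList f ⇔ u ≡ u₀
      inducedWord≡⇔u₀ u = mk⇔
        (λ eq → lookup-injective λ j →
          trans (cong (lookup u) (sym (φ-section j)))
                (trans (to (inducedWord≡⇔ u f) eq (section j)) (sym (u₀-section j))))
        (λ { refl → from (inducedWord≡⇔ u₀ f) u₀∘φ≗f })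

      u₀-proper⇔ : Proper (contract 𝒢 E∈𝒢 ready) (lookup u₀) ⇔ Proper (delete 𝒢 E∈𝒢) (lookup f)
      u₀-proper⇔ = mk⇔
        (Proper-cong u₀∘φ≗f ∘ to (Proper-identify φ (delete 𝒢 E∈𝒢)))
        (from (Proper-identify φ (delete 𝒢 E∈𝒢)) ∘ Proper-cong (sym ∘ u₀∘φ≗f))

      induced≈deleted : induce k≤ℓ r Contraction (toList f) ≈ Y (delete 𝒢 E∈𝒢) (toList f)
      induced≈deleted = ≈-trans
        (induce-single k≤ℓ r Contraction
          -- The letters of `u₀` are among those of `f`, so they do not exceed the cutoff of the
          -- sum.
          (λ j → subst (λ y → value y ≤ max 0 (map value (toList f))) (sym (u₀-section j))
                       (letters≤max f (section j)))
          inducedWord≡⇔u₀)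
        (Y-cong (contract 𝒢 E∈𝒢 ready) (delete 𝒢 E∈𝒢) u₀ f u₀-proper⇔)

    deletion-contraction : Y 𝒢 ≋ Y (delete 𝒢 E∈𝒢) ⊖ induce k≤ℓ r Contraction
    deletion-contraction w with length w ℕ.≟ n
    ... | no ∣w∣≢n = deletion-contraction-length ∣w∣≢n
    -- Matching on `refl` sets `n` to the length of `w`, so that `fromList w` is a coloring of
    -- `[n]`.
    ... | yes refl = subst (λ w → Y 𝒢 w ≈ Y (delete 𝒢 E∈𝒢) w - induce k≤ℓ r Contraction w)
                           (Vec.toList∘fromList w) (at (fromList w))
      where
      at : ∀ f → Y 𝒢 (toList f) ≈ Y (delete 𝒢 E∈𝒢) (toList f) - induce k≤ℓ r Contraction (toList f)
      at f with any? (λ (u , v) → ¬? (lookup f u ≟ℙ lookup f v)) (List⁺.toList E)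
      ... | yes fE = deletion-contraction-proper f fE
      ... | no ¬fE = deletion-contraction-improper f ¬fE

theorem2p4 : ∀ {c ℓ₁ ℓ₂} (K : HeytingField c ℓ₁ ℓ₂) → PowerSeries.CharacteristicZero K →
    let open PowerSeries K in
    ∀ {n : ℕ} (𝒢 : Plurigraph (Fin n)) (E : Pluriedge (Fin n)) (E∈𝒢 : E ∈ 𝒢)
    {ℓ : ℕ} (B : Fin ℓ → Subset n) (k : ℕ) (ready : IsContractionReady E B k) →
    let open IsContractionReady ready in
    Y 𝒢 ≋ Y (delete 𝒢 E∈𝒢) ⊖ induce k≤ℓ r (Y (contract 𝒢 E∈𝒢 ready))
theorem2p4 K _ 𝒢 E E∈𝒢 B k ready = Coefficients.deletion-contraction K E∈𝒢 ready
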